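{- For non-negative monotone submodular $f$ under a $k$-uniform matroid constraint (for every positive integer $k$), there exists a deterministic online algorithm with free disposal whose competitive ratio is at least $$\min_{k}\max\left\{\frac1k,\frac1{\alpha_k}\right\}=\frac1{\alpha_4}>0.2959,$$ where the minimum is over positive integers $k$.
   Context: For an integer $k\ge4$, $\alpha_k$ is the unique root in the interval $(3,4)$ of the equation $a=\left(1+\frac{a-2}{k+1}\right)^{k+1}$. For $k\le 3$ the expression $\max\{\frac1k,\frac1{\alpha_k}\}$ is understood to be $\frac1k$. Online problem with free disposal ($k$-uniform matroid): $\Omega$ is a ground set and $f:2^\Omega\to\mathbb{R}_+$ is submodular and monotone ($S\subseteq T$ implies $f(S)\le f(T)$). Distinct elements of $\Omega$ arrive one by one in a finite sequence whose length is unknown to the algorithm. The algorithm maintains a set $S$, initially empty, with $|S|\le k$. In each round, when $u$ arrives, it may remove elements from $S$ and may include $u$ in $S$, provided $|S|\le k$ afterwards; rejected or removed elements cannot be retrieved. $f$ is accessed by a value oracle on sets of arrived elements. $\mathsf{OPT}$ is a subset of at most $k$ elements of the sequence maximizing $f$. A deterministic algorithm has competitive ratio (at least) $r$ if at the end of every finite sequence, $f(S)\ge r\cdot f(\mathsf{OPT})$. -}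

module Defs where

open import Algebra.Bundles using (CommutativeRing)
open import Algebra.Core using (Op₁; Op₂)
import Algebra.Construct.NaturalChoice.Max as Max
import Algebra.Properties.Semiring.Exp as Exp
import Algebra.Properties.Semiring.Mult as Mult
import Algebra.Structures as Structures
open import Data.Bool.Base using (if_then_else_)
open import Data.Fin.Base using (Fin)
open import Data.Fin.Subset as Subset using (Subset; inside; ∣_∣)
open import Data.Nat.Base as ℕ using (ℕ; zero; suc; NonZero)
open import Data.Product.Base using (Σ; ∃; _×_; _,_)
open import Data.Vec.Base using (Vec; []; _∷_; lookup)
open import Data.Vec.Relation.Unary.Unique.Propositional using (Unique)
open import Level using (0ℓ)
open import Relation.Binary.Bundles using (DecTotalOrder)
open import Relation.Binary.Core using (Rel)
import Relation.Binary.Construct.NonStrictToStrict as NonStrictToStrict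
open import Relation.Binary.PropositionalEquality.Core using (_≡_; _≢_)
open import Relation.Binary.Structures using (IsDecTotalOrder)
open import Relation.Unary using (Pred; Satisfiable; _∈_; _⊆_; _∪_; _∩_)

-- The real numbers, axiomatised classically as a complete ordered field (which
-- is unique up to isomorphism).  The order is decidable because an algorithm
-- may compare the real values returned by the oracle.  As usual for a total
-- inverse, 0# ⁻¹ is an unspecified element.
record RealNumbers : Set₁ where
  infix  8 _⁻¹
  infix  8 -_
  infixl 7 _*_
  infixl 6 _+_
  infix  4 _≤_
  field
    ℝ                 : Set
    _+_ _*_           : Op₂ ℝ
    -_ _⁻¹            : Op₁ ℝ
    0# 1#             : ℝ
    _≤_               : Rel ℝ 0ℓ
    isCommutativeRing : Structures.IsCommutativeRing {A = ℝ} _≡_ _+_ _*_ -_ 0# 1#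
    0≢1               : 0# ≢ 1#
    ⁻¹-inverseʳ       : ∀ x → x ≢ 0# → x * x ⁻¹ ≡ 1#
    isDecTotalOrder   : IsDecTotalOrder {A = ℝ} _≡_ _≤_
    +-monoˡ-≤         : ∀ z {x y} → x ≤ y → x + z ≤ y + z
    *-nonNeg          : ∀ {x y} → 0# ≤ x → 0# ≤ y → 0# ≤ x * y

  UpperBound : Pred ℝ 0ℓ → ℝ → Set
  UpperBound P b = ∀ x → x ∈ P → x ≤ b

  field
    supremum : (P : Pred ℝ 0ℓ) → Satisfiable P → ∃ (UpperBound P) →
               ∃ λ s → UpperBound P s × (∀ b → UpperBound P b → s ≤ b)

  commutativeRing : CommutativeRing 0ℓ 0ℓ
  commutativeRing = record { isCommutativeRing = isCommutativeRing }

  decTotalOrder : DecTotalOrder 0ℓ 0ℓ 0ℓ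
  decTotalOrder = record { isDecTotalOrder = isDecTotalOrder }

  open Exp (CommutativeRing.semiring commutativeRing) public using (_^_)
  open Mult (CommutativeRing.semiring commutativeRing) public using () renaming (_×_ to _·_)
  open CommutativeRing commutativeRing public using (_-_)
  open Max (DecTotalOrder.totalOrder decTotalOrder) public using (_⊔_)
  open NonStrictToStrict {A = ℝ} _≡_ _≤_ public using (_<_)

  fromℕ : ℕ → ℝ
  fromℕ n = n · 1#

module OnlineMaximisation (R : RealNumbers) where

  open RealNumbers R

  Root : ℕ → ℝ → Set
  Root k a = fromℕ 3 < a × a < fromℕ 4 ×
             a ≡ (1# + (a - fromℕ 2) * fromℕ (suc k) ⁻¹) ^ suc k

  UniqueRoot : ℕ → ℝ → Set
  UniqueRoot k a = Root k a × (∀ b → Root k b → b ≡ a)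

  -- max {1/k , 1/αₖ}, read as 1/k when k ≤ 3; the values α 0, …, α 3 are unused.
  ratio : (α : ℕ → ℝ) → ℕ → ℝ
  ratio α k = if k ℕ.≤ᵇ 3 then fromℕ k ⁻¹ else (fromℕ k ⁻¹ ⊔ α k ⁻¹)

  -- m is the minimum of g over the positive integers.
  IsMinimum⁺ : (ℕ → ℝ) → ℝ → Set
  IsMinimum⁺ g m = (Σ ℕ λ k → NonZero k × g k ≡ m) × (∀ k → NonZero k → m ≤ g k)

  -- Subsets of Ω are predicates.  Monotonicity makes f independent of the
  -- choice of predicate representing a given subset.
  module _ {Ω : Set} (f : Pred Ω 0ℓ → ℝ) where

    NonNegative : Set₁
    NonNegative = ∀ S → 0# ≤ f S

    Monotone : Set₁
    Monotone = ∀ S T → S ⊆ T → f S ≤ f T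

    Submodular : Set₁
    Submodular = ∀ S T → f (S ∪ T) + f (S ∩ T) ≤ f S + f T

  -- The n elements which have arrived so far are numbered by Fin n, the most
  -- recent one being number zero, so that a set of arrived elements is a
  -- Subset n.  When an element u arrives, the algorithm sees the oracle for f
  -- on sets of arrived elements (u included) and its current set S, and returns
  -- the new set; it knows neither Ω nor the future.  Further memory is
  -- redundant: the oracle determines all earlier oracles, hence the whole
  -- history of the run.
  record OnlineAlgorithm (k : ℕ) : Set where
    field
      update   : ∀ {n} → (Subset (suc n) → ℝ) → Subset n → Subset (suc n)
      -- Every element of the new set is u or an element of S.
      update-⊆ : ∀ {n} (v : Subset (suc n) → ℝ) (S : Subset n) →
                 update v S Subset.⊆ inside ∷ S
      update-≤ : ∀ {n} (v : Subset (suc n) → ℝ) (S : Subset n) →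
                 ∣ S ∣ ℕ.≤ k → ∣ update v S ∣ ℕ.≤ k

  module _ {Ω : Set} where

    -- The subset of Ω given by a set of positions in a sequence.
    ⟦_⟧ : ∀ {n} → Vec Ω n → Subset n → Pred Ω 0ℓ
    ⟦ us ⟧ S ω = ∃ λ i → i Subset.∈ S × lookup us i ≡ ω

    -- Sequences are listed with the most recent arrival first.
    run : ∀ {k} → OnlineAlgorithm k → (Pred Ω 0ℓ → ℝ) → ∀ {n} → Vec Ω n → Subset n
    run A f []       = []
    run A f (u ∷ us) = OnlineAlgorithm.update A (λ T → f (⟦ u ∷ us ⟧ T)) (run A f us)

    IsOPT : ℕ → (Pred Ω 0ℓ → ℝ) → ∀ {n} → Vec Ω n → Subset n → Set
    IsOPT k f us O = ∣ O ∣ ℕ.≤ k × (∀ T → ∣ T ∣ ℕ.≤ k → f (⟦ us ⟧ T) ≤ f (⟦ us ⟧ O))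

  CompetitiveRatioAtLeast : ∀ {k} → OnlineAlgorithm k → ℝ → Set₁
  CompetitiveRatioAtLeast {k} A r =
    (Ω : Set) (f : Pred Ω 0ℓ → ℝ) → NonNegative f → Monotone f → Submodular f →
    ∀ {n} (us : Vec Ω n) → Unique us → ∀ OPT → IsOPT k f us OPT →
    r * f (⟦ us ⟧ OPT) ≤ f (⟦ us ⟧ (run A f us))

module Submission where

open import Defs
open import Data.Nat using (ℕ; NonZero) renaming (_≤_ to _≤ℕ_)
open import Data.Product using (Σ; _×_)

open import Algebra.Bundles using (CommutativeRing)
import Algebra.Construct.NaturalChoice.Max as Max
import Algebra.Properties.CommutativeSemiring.Exp as Exp
import Algebra.Properties.Ring as RingProperties
import Algebra.Properties.Semiring.Mult as Mult
import Algebra.Solver.Ring.NaturalCoefficients.Default as Solver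
open import Data.Fin.Base using (Fin; zero; suc)
open import Data.Fin.Subset using (Subset; inside; outside; ⊥; ⁅_⁆; ∣_∣; _∈_; _⊆_; _∩_; _∪_)
open import Data.Fin.Subset.Properties
open import Data.Nat.Base as ℕ using (zero; suc)
import Data.Nat.Properties as ℕ
open import Data.Product using (∃; _,_; proj₁; proj₂)
open import Data.Sum.Base using (_⊎_; inj₁; inj₂; [_,_]′)
open import Data.Unit.Base using (tt)
open import Data.Vec.Base using (Vec; []; _∷_; lookup; here; there; _[_]≔_)
open import Function.Base using (_∘_)
open import Level using (0ℓ)
open import Relation.Binary.Bundles using (DecTotalOrder)
open import Relation.Binary.PropositionalEquality
open import Relation.Nullary using (¬_; yes; no; contradiction)
open import Relation.Nullary.Decidable using (toWitness)
open import Relation.Unary using (Pred)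
import Relation.Unary as Unary

-- For k ≥ 4 let a = αₖ and r = 1 + (a − 2)/(k + 1), so that r ^ (k + 1) = a.
-- An arriving element u gets the weight f(A ∪ u) − f(A), where A is the set of
-- all elements accepted so far.  It is accepted if k times its weight is at
-- least the slack a w(S) − w(A), and then replaces the lightest element of S
-- if S is full.  As long as the slack never decreases, every rejected element
-- has a marginal value of at most slack / k, and therefore
--   f(OPT) ≤ f(A) + slack = f(∅) + a w(S) ≤ a f(S).
-- Monotonicity of the slack follows from the invariant that it is at least
-- r w₁ + r² w₂ + …, where w₁, w₂, … are the weights in S from the newest to
-- the oldest element.  The value of r is the one which makes this invariant
-- self-reproducing: it is a double root of k z^(k+1) − (k + a − 1) z^k + a,
-- the characteristic polynomial of the slack under repeated acceptance of
-- elements with weight exactly slack / k.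
--
-- For k ≤ 3 it suffices to keep the best single element.  Finally αₖ ≤ α₄,
-- because (1 + x / n)^n increases with n and is convex in x.

-- Arithmetic of ordered fields.

module OrderedField (R : RealNumbers) where

  open RealNumbers R
  open CommutativeRing commutativeRing using
    ( commutativeSemiring; ring; semiring; *-comm; *-assoc; *-identityʳ; *-identityˡ
    ; +-comm; +-assoc; +-identityʳ; +-identityˡ; zeroʳ; -‿inverseˡ; -‿inverseʳ)
  open DecTotalOrder decTotalOrder public using (_≤?_) renaming
    ( refl to ≤-refl; reflexive to ≤-reflexive; trans to ≤-trans
    ; antisym to ≤-antisym; total to ≤-total)
  open Solver commutativeSemiring public using (solve; _:=_; _:+_; _:*_; con)

  <⇒≱ : ∀ {x y} → x < y → ¬ (y ≤ x)
  <⇒≱ (x≤y , x≢y) y≤x = x≢y (≤-antisym x≤y y≤x)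

  ≰⇒> : ∀ {x y} → ¬ (x ≤ y) → y < x
  ≰⇒> {x} {y} x≰y with ≤-total x y
  ... | inj₁ x≤y = contradiction x≤y x≰y
  ... | inj₂ y≤x = y≤x , λ y≡x → x≰y (≤-reflexive (sym y≡x))

  <-≤-trans : ∀ {x y z} → x < y → y ≤ z → x < z
  <-≤-trans x<y y≤z = ≤-trans (proj₁ x<y) y≤z , λ { refl → <⇒≱ x<y y≤z }

  difference : ∀ x y → ∃ λ d → y ≡ x + d
  difference x y = y - x ,
    trans (sym (trans (cong (_+ y) (-‿inverseʳ x)) (+-identityˡ y)))
          (solve 3 (λ x y m → (x :+ m) :+ y := x :+ (y :+ m)) refl x y (- x))

  +-cancelʳ-≤ : ∀ z {x y} → x + z ≤ y + z → x ≤ y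
  +-cancelʳ-≤ z {x} {y} le = subst₂ _≤_ (undo x) (undo y) (+-monoˡ-≤ (- z) le)
    where
    undo : ∀ x → x + z + - z ≡ x
    undo x = trans (+-assoc x z (- z)) (trans (cong (x +_) (-‿inverseʳ z)) (+-identityʳ x))

  +-mono-≤ : ∀ {x y u v} → x ≤ y → u ≤ v → x + u ≤ y + v
  +-mono-≤ {x} {y} {u} {v} x≤y u≤v =
    ≤-trans (+-monoˡ-≤ u x≤y) (subst₂ _≤_ (+-comm u y) (+-comm v y) (+-monoˡ-≤ y u≤v))

  -- Applied to a suitable combination of hypotheses, this turns a linear
  -- inequality into an identity that the semiring solver can prove.
  ≤-by : ∀ {x y z w} → x ≤ y → z + y ≡ w + x → z ≤ w
  ≤-by {x} {y} {z} {w} x≤y eq = +-cancelʳ-≤ y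
    (≤-trans (≤-reflexive eq) (+-mono-≤ (≤-refl {w}) x≤y))

  *-monoˡ-≤ : ∀ {z x y} → 0# ≤ z → x ≤ y → z * x ≤ z * y
  *-monoˡ-≤ {z} {x} {y} 0≤z x≤y with difference x y
  ... | d , refl = ≤-by (*-nonNeg 0≤z 0≤d)
          (solve 3 (λ x z d → z :* x :+ z :* d := z :* (x :+ d) :+ con 0) refl x z d)
    where
    0≤d : 0# ≤ d
    0≤d = ≤-by x≤y (solve 2 (λ x d → con 0 :+ (x :+ d) := d :+ x) refl x d)

  *-mono-≤ : ∀ {x y u v} → 0# ≤ x → 0# ≤ v → x ≤ y → u ≤ v → x * u ≤ y * v
  *-mono-≤ {x} {y} {u} {v} 0≤x 0≤v x≤y u≤v = ≤-trans (*-monoˡ-≤ 0≤x u≤v)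
    (subst₂ _≤_ (*-comm v x) (*-comm v y) (*-monoˡ-≤ 0≤v x≤y))

  0≤x² : ∀ x → 0# ≤ x * x
  0≤x² x with ≤-total 0# x
  ... | inj₁ 0≤x = *-nonNeg 0≤x 0≤x
  ... | inj₂ x≤0 = subst (0# ≤_) (-x*-x x) (*-nonNeg 0≤-x 0≤-x)
    where
    0≤-x : 0# ≤ - x
    0≤-x = ≤-by x≤0 (trans (+-identityˡ 0#) (sym (-‿inverseˡ x)))
    -x*-x : ∀ x → - x * - x ≡ x * x
    -x*-x x = trans (sym (-‿distribˡ-* x (- x)))
      (trans (cong -_ (sym (-‿distribʳ-* x x))) (-‿involutive (x * x)))
      where open RingProperties ring

  0≤1 : 0# ≤ 1#
  0≤1 = subst (0# ≤_) (*-identityʳ 1#) (0≤x² 1#)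

  0<1 : 0# < 1#
  0<1 = 0≤1 , 0≢1

  x≤x+y : ∀ {x y} → 0# ≤ y → x ≤ x + y
  x≤x+y {x} {y} 0≤y = ≤-by 0≤y (sym (+-identityʳ (x + y)))

  0≤+ : ∀ {x y} → 0# ≤ x → 0# ≤ y → 0# ≤ x + y
  0≤+ 0≤x 0≤y = ≤-trans 0≤x (x≤x+y 0≤y)

  0≤^ : ∀ {x} n → 0# ≤ x → 0# ≤ x ^ n
  0≤^ zero    0≤x = 0≤1
  0≤^ (suc n) 0≤x = *-nonNeg 0≤x (0≤^ n 0≤x)

  ^-monoˡ-≤ : ∀ {x y} n → 0# ≤ x → x ≤ y → x ^ n ≤ y ^ n
  ^-monoˡ-≤ zero    0≤x x≤y = ≤-refl
  ^-monoˡ-≤ (suc n) 0≤x x≤y =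
    *-mono-≤ 0≤x (0≤^ n (≤-trans 0≤x x≤y)) x≤y (^-monoˡ-≤ n 0≤x x≤y)

  >⇒≢0 : ∀ {x} → 0# < x → x ≢ 0#
  >⇒≢0 (_ , 0≢x) x≡0 = 0≢x (sym x≡0)

  inverseʳ : ∀ {x} → 0# < x → x * x ⁻¹ ≡ 1#
  inverseʳ 0<x = ⁻¹-inverseʳ _ (>⇒≢0 0<x)

  0≤⁻¹ : ∀ {x} → 0# < x → 0# ≤ x ⁻¹
  0≤⁻¹ {x} 0<x with ≤-total 0# (x ⁻¹)
  ... | inj₁ 0≤x⁻¹ = 0≤x⁻¹
  ... | inj₂ x⁻¹≤0 = contradiction
    (subst₂ _≤_ (inverseʳ 0<x) (zeroʳ x) (*-monoˡ-≤ (proj₁ 0<x) x⁻¹≤0)) (<⇒≱ 0<1)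

  *-cancelˡ-≤ : ∀ {z x y} → 0# < z → z * x ≤ z * y → x ≤ y
  *-cancelˡ-≤ {z} {x} {y} 0<z le = subst₂ _≤_ (undo x) (undo y) (*-monoˡ-≤ (0≤⁻¹ 0<z) le)
    where
    undo : ∀ x → z ⁻¹ * (z * x) ≡ x
    undo x = trans (solve 3 (λ z i x → i :* (z :* x) := (z :* i) :* x) refl z (z ⁻¹) x)
      (trans (cong (_* x) (inverseʳ 0<z)) (*-identityˡ x))

  ⁻¹-*-≤ : ∀ {z x y} → 0# < z → x ≤ z * y → z ⁻¹ * x ≤ y
  ⁻¹-*-≤ {z} {x} {y} 0<z x≤zy = *-cancelˡ-≤ 0<z
    (subst (_≤ z * y) (sym (trans (sym (*-assoc z (z ⁻¹) x))
      (trans (cong (_* x) (inverseʳ 0<z)) (*-identityˡ x)))) x≤zy)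

  ⁻¹-anti-≤ : ∀ {x y} → 0# < x → x ≤ y → y ⁻¹ ≤ x ⁻¹
  ⁻¹-anti-≤ {x} {y} 0<x x≤y = subst (_≤ x ⁻¹) (*-identityʳ (y ⁻¹))
    (⁻¹-*-≤ (<-≤-trans 0<x x≤y)
      (subst (_≤ y * x ⁻¹) (inverseʳ 0<x) (*-mono-≤ (proj₁ 0<x) (0≤⁻¹ 0<x) x≤y ≤-refl)))

  open Mult semiring using (×-homo-+; ×1-homo-*)
  open Exp commutativeSemiring public using (^-distrib-*)

  fromℕ-+ : ∀ m n → fromℕ (m ℕ.+ n) ≡ fromℕ m + fromℕ n
  fromℕ-+ = ×-homo-+ 1#

  fromℕ-* : ∀ m n → fromℕ (m ℕ.* n) ≡ fromℕ m * fromℕ n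
  fromℕ-* = ×1-homo-*

  fromℕ-^ : ∀ m n → fromℕ (m ℕ.^ n) ≡ fromℕ m ^ n
  fromℕ-^ m zero    = +-identityʳ 1#
  fromℕ-^ m (suc n) = trans (fromℕ-* m (m ℕ.^ n)) (cong (fromℕ m *_) (fromℕ-^ m n))

  0≤fromℕ : ∀ n → 0# ≤ fromℕ n
  0≤fromℕ zero    = ≤-refl
  0≤fromℕ (suc n) = 0≤+ 0≤1 (0≤fromℕ n)

  fromℕ-mono-≤ : ∀ {m n} → m ℕ.≤ n → fromℕ m ≤ fromℕ n
  fromℕ-mono-≤ {m} {n} m≤n = subst (λ n → fromℕ m ≤ fromℕ n) (ℕ.m+[n∸m]≡n m≤n)
    (subst (fromℕ m ≤_) (sym (fromℕ-+ m (n ℕ.∸ m))) (x≤x+y (0≤fromℕ (n ℕ.∸ m))))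

  0<fromℕ : ∀ n → 0# < fromℕ (suc n)
  0<fromℕ n = <-≤-trans 0<1 (x≤x+y (0≤fromℕ n))

  fromℕ-mono-< : ∀ {m n} → m ℕ.< n → fromℕ m < fromℕ n
  fromℕ-mono-< {m} {n} m<n = <-≤-trans m<1+m (fromℕ-mono-≤ m<n)
    where
    m<1+m : fromℕ m < fromℕ (suc m)
    m<1+m = ≰⇒> λ 1+m≤m → <⇒≱ 0<1 (≤-by 1+m≤m (sym (+-identityˡ _)))

-- Monotonicity of the roots in k and the numerical bound at k = 4.

module Roots (R : RealNumbers) where

  open RealNumbers R
  open OrderedField R
  open OnlineMaximisation R
  open CommutativeRing commutativeRing using (*-identityʳ; +-identityˡ; *-comm; *-assoc; distribˡ; -‿inverseʳ)

  growth : ℕ → ℝ → ℝ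
  growth k x = (1# + x * fromℕ (suc k) ⁻¹) ^ suc k

  2pq≤p²+q² : ∀ p q → p * q + p * q ≤ p * p + q * q
  2pq≤p²+q² p q with difference p q
  ... | d , refl = ≤-by (0≤x² d)
    (solve 2 (λ p d → (p :* (p :+ d) :+ p :* (p :+ d)) :+ d :* d
                   := (p :* p :+ (p :+ d) :* (p :+ d)) :+ con 0) refl p d)

  -- The graph of x ↦ x ^ suc n lies above its tangent at p.
  tangent-≤ : ∀ n {p q} → 0# ≤ p → 0# ≤ q →
              fromℕ (suc n) * (p ^ n * q) ≤ q ^ suc n + fromℕ n * p ^ suc n
  tangent-≤ zero {p} {q} _ _ = ≤-reflexive
    (solve 2 (λ p q → (con 1 :+ con 0) :* (con 1 :* q) := q :* con 1 :+ con 0 :* (p :* con 1)) refl p q)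
  tangent-≤ (suc n) {p} {q} 0≤p 0≤q = ≤-by
    (+-mono-≤ (*-monoˡ-≤ 0≤q (tangent-≤ n 0≤p 0≤q))
              (*-monoˡ-≤ (*-nonNeg (0≤fromℕ (suc n)) (0≤^ n 0≤p)) (2pq≤p²+q² p q)))
    (solve 5 (λ p q N P Q →
      (con 1 :+ (con 1 :+ N)) :* ((p :* P) :* q)
        :+ (q :* (q :* Q :+ N :* (p :* P)) :+ (con 1 :+ N) :* P :* (p :* p :+ q :* q))
      := (q :* (q :* Q) :+ (con 1 :+ N) :* (p :* (p :* P)))
        :+ (q :* ((con 1 :+ N) :* (P :* q)) :+ (con 1 :+ N) :* P :* (p :* q :+ p :* q)))
      refl p q (fromℕ n) (p ^ n) (q ^ n))

  0≤quotient : ∀ k {x} → 0# ≤ x → 0# ≤ x * fromℕ (suc k) ⁻¹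
  0≤quotient k 0≤x = *-nonNeg 0≤x (0≤⁻¹ (0<fromℕ k))

  *-quotient : ∀ k x → fromℕ (suc k) * (1# + x * fromℕ (suc k) ⁻¹) ≡ fromℕ (suc k) + x
  *-quotient k x = trans
    (solve 3 (λ K x i → K :* (con 1 :+ x :* i) := K :+ x :* (K :* i)) refl K x (K ⁻¹))
    (cong (K +_) (trans (cong (x *_) (inverseʳ (0<fromℕ k))) (*-identityʳ x)))
    where K = fromℕ (suc k)

  -- The bases `p` and `q` of the two powers satisfy (k + 2) q = (k + 1) p + 1. Inserting this into
  -- the tangent inequality at `p` cancels (k + 1) p ^ (k + 2) and leaves the claim.
  growth-suc-≤ : ∀ k {x} → 0# ≤ x → growth k x ≤ growth (suc k) x
  growth-suc-≤ k {x} 0≤x = ≤-by (tangent-≤ (suc k) (0≤base k) (0≤base (suc k)))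
    (trans (solve 4 (λ p P Q K → P :+ (Q :+ K :* (p :* P)) := Q :+ P :* (K :* p :+ con 1))
             refl p (p ^ suc k) (q ^ suc (suc k)) K)
      (cong (q ^ suc (suc k) +_)
        (trans (cong (p ^ suc k *_) mean)
          (solve 3 (λ P K q → P :* (K :* q) := K :* (P :* q)) refl (p ^ suc k) (1# + K) q))))
    where
    K = fromℕ (suc k)
    base : ℕ → ℝ
    base k = 1# + x * fromℕ (suc k) ⁻¹
    p = base k
    q = base (suc k)
    0≤base : ∀ k → 0# ≤ base k
    0≤base k = 0≤+ 0≤1 (0≤quotient k 0≤x)
    mean : K * p + 1# ≡ (1# + K) * q
    mean = trans (cong (_+ 1#) (*-quotient k x))
      (trans (solve 2 (λ K x → (K :+ x) :+ con 1 := (con 1 :+ K) :+ x) refl K x)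
             (sym (*-quotient (suc k) x)))

  growth-mono-≤ : ∀ {j k x} → 0# ≤ x → j ℕ.≤ k → growth j x ≤ growth k x
  growth-mono-≤ 0≤x j≤k = go 0≤x (ℕ.≤⇒≤′ j≤k)
    where
    go : ∀ {j k x} → 0# ≤ x → j ℕ.≤′ k → growth j x ≤ growth k x
    go 0≤x ℕ.≤′-refl             = ≤-refl
    go 0≤x (ℕ.≤′-step {k} j≤′k) = ≤-trans (go 0≤x j≤′k) (growth-suc-≤ k 0≤x)

  -- The slope of x ↦ (1 + x w) ^ n between 0 and b is at most that between 0
  -- and c.
  secant-≤ : ∀ n {b c w} → 0# ≤ b → b ≤ c → 0# ≤ w →
             c * (1# + b * w) ^ n + b ≤ b * (1# + c * w) ^ n + c
  secant-≤ zero {b} {c} 0≤b b≤c 0≤w = ≤-reflexive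
    (solve 2 (λ b c → c :* con 1 :+ b := b :* con 1 :+ c) refl b c)
  secant-≤ (suc n) {b} {c} {w} 0≤b b≤c 0≤w = ≤-by
    (+-mono-≤ (secant-≤ n 0≤b b≤c 0≤w)
      (*-monoˡ-≤ (*-nonNeg (*-nonNeg 0≤b (≤-trans 0≤b b≤c)) 0≤w)
        (^-monoˡ-≤ n (0≤+ 0≤1 (*-nonNeg 0≤b 0≤w)) (+-mono-≤ ≤-refl b*w≤c*w))))
    (solve 5 (λ b c w U V →
      (c :* ((con 1 :+ b :* w) :* U) :+ b) :+ ((b :* V :+ c) :+ b :* c :* w :* V)
      := (b :* ((con 1 :+ c :* w) :* V) :+ c) :+ ((c :* U :+ b) :+ b :* c :* w :* U))
      refl b c w ((1# + b * w) ^ n) ((1# + c * w) ^ n))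
    where
    b*w≤c*w : b * w ≤ c * w
    b*w≤c*w = subst₂ _≤_ (*-comm w b) (*-comm w c) (*-monoˡ-≤ 0≤w b≤c)

  -- The convex function `growth k` starts at 1, below the line z ↦ 2 + z. Once it has reached the
  -- line at `x`, convexity keeps it strictly above the line beyond `x`, so no intersection `y` lies
  -- there.
  fixedPoint-≤ : ∀ k {x y} → 0# ≤ x → fromℕ 2 + x ≤ growth k x → growth k y ≡ fromℕ 2 + y → y ≤ x
  fixedPoint-≤ k {x} {y} 0≤x above fixed with ≤-total y x
  ... | inj₁ y≤x = y≤x
  ... | inj₂ x≤y = ≤-by
    (+-mono-≤ (secant-≤ (suc k) 0≤x x≤y (0≤⁻¹ (0<fromℕ k)))
              (*-monoˡ-≤ (≤-trans 0≤x x≤y) above))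
    (trans (cong (λ V → y + ((x * V + y) + y * growth k x)) fixed)
      (solve 3 (λ x y U →
        y :+ ((x :* (con 1 :+ (con 1 :+ con 0) :+ y) :+ y) :+ y :* U)
        := x :+ ((y :* U :+ x) :+ y :* (con 1 :+ (con 1 :+ con 0) :+ x)))
        refl x y (growth k x)))

  2+[a-2]≡a : ∀ a → fromℕ 2 + (a - fromℕ 2) ≡ a
  2+[a-2]≡a a = trans
    (solve 3 (λ t a m → t :+ (a :+ m) := (t :+ m) :+ a) refl (fromℕ 2) a (- fromℕ 2))
    (trans (cong (_+ a) (-‿inverseʳ (fromℕ 2))) (+-identityˡ a))

  module _ (k : ℕ) {a : ℝ} (root : Root k a) where

    0<root : 0# < a
    0<root = <-≤-trans (0<fromℕ 2) (proj₁ (proj₁ root))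

    root-growth : growth k (a - fromℕ 2) ≡ fromℕ 2 + (a - fromℕ 2)
    root-growth = trans (sym (proj₂ (proj₂ root))) (sym (2+[a-2]≡a a))

    1≤root-2 : 1# ≤ a - fromℕ 2
    1≤root-2 = ≤-by (proj₁ (proj₁ root))
      (trans (cong (1# +_) (sym (2+[a-2]≡a a)))
        (solve 1 (λ x → con 1 :+ (con 1 :+ (con 1 :+ con 0) :+ x)
                     := x :+ (con 1 :+ (con 1 :+ (con 1 :+ con 0)))) refl (a - fromℕ 2)))

    root-≤ : ∀ {x} → 0# ≤ x → fromℕ 2 + x ≤ growth k x → a ≤ fromℕ 2 + x
    root-≤ {x} 0≤x above = subst (_≤ fromℕ 2 + x) (2+[a-2]≡a a)
      (+-mono-≤ ≤-refl (fixedPoint-≤ k 0≤x above root-growth))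

  -- At a - 2 the function `growth j` meets the line z ↦ 2 + z, and `growth k` is at least as large
  -- there, so its own intersection comes no later.
  root-anti-≤ : ∀ {j k a b} → j ℕ.≤ k → Root j a → Root k b → b ≤ a
  root-anti-≤ {j} {k} {a} {b} j≤k rootᵃ rootᵇ = subst (b ≤_) (2+[a-2]≡a a)
    (root-≤ k rootᵇ 0≤x (≤-trans (≤-reflexive (sym (root-growth j rootᵃ))) (growth-mono-≤ 0≤x j≤k)))
    where
    0≤x = ≤-trans 0≤1 (1≤root-2 j rootᵃ)

  -- 98 / 29 lies between α₄ = 3.378… and 1 / 0.2959 = 3.379….
  root₄-≤ : ∀ {a} → Root 4 a → fromℕ 29 * a ≤ fromℕ 98
  root₄-≤ {a} root = ≤-trans (*-monoˡ-≤ (0≤fromℕ 29) (root-≤ 4 root 0≤x above)) (≤-reflexive 29*[2+x]≡98)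
    where
    x u : ℝ
    x = fromℕ 40 * fromℕ 29 ⁻¹
    u = 1# + x * fromℕ 5 ⁻¹
    0≤x : 0# ≤ x
    0≤x = *-nonNeg (0≤fromℕ 40) (0≤⁻¹ (0<fromℕ 28))
    29*x≡40 : fromℕ 29 * x ≡ fromℕ 40
    29*x≡40 = trans
      (solve 3 (λ t f i → t :* (f :* i) := f :* (t :* i)) refl (fromℕ 29) (fromℕ 40) (fromℕ 29 ⁻¹))
      (trans (cong (fromℕ 40 *_) (inverseʳ (0<fromℕ 28))) (*-identityʳ (fromℕ 40)))
    29*[2+x]≡98 : fromℕ 29 * (fromℕ 2 + x) ≡ fromℕ 98
    29*[2+x]≡98 = trans (distribˡ (fromℕ 29) (fromℕ 2) x)
      (trans (cong₂ _+_ (sym (fromℕ-* 29 2)) 29*x≡40) (sym (fromℕ-+ 58 40)))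
    145*u≡185 : fromℕ 145 * u ≡ fromℕ 185
    145*u≡185 = trans (cong (_* u) (fromℕ-* 29 5))
      (trans (*-assoc (fromℕ 29) (fromℕ 5) u)
      (trans (cong (fromℕ 29 *_) (*-quotient 4 x))
      (trans (distribˡ (fromℕ 29) (fromℕ 5) x)
      (trans (cong₂ _+_ (sym (fromℕ-* 29 5)) 29*x≡40) (sym (fromℕ-+ 145 40))))))
    145⁵*u⁵≡185⁵ : fromℕ 145 ^ 5 * u ^ 5 ≡ fromℕ (185 ℕ.^ 5)
    145⁵*u⁵≡185⁵ = trans (sym (^-distrib-* (fromℕ 145) u 5))
      (trans (cong (_^ 5) 145*u≡185) (sym (fromℕ-^ 185 5)))
    -- Since u = 185 / 145, clearing denominators leaves 145 ^ 5 · 98 ≤ 29 · 185 ^ 5, an inequality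
    -- of natural numbers that is decided by evaluation.
    above : fromℕ 2 + x ≤ growth 4 x
    above = *-cancelˡ-≤ (0<fromℕ 28) (*-cancelˡ-≤ 0<145⁵ (subst₂ _≤_ left right
      (fromℕ-mono-≤ (toWitness {a? = (145 ℕ.^ 5) ℕ.* 98 ℕ.≤? 29 ℕ.* (185 ℕ.^ 5)} tt))))
      where
      0<145⁵ : 0# < fromℕ 145 ^ 5
      0<145⁵ = subst (0# <_) (fromℕ-^ 145 5)
        (fromℕ-mono-< {0} {145 ℕ.^ 5} (toWitness {a? = 0 ℕ.<? 145 ℕ.^ 5} tt))
      left : fromℕ ((145 ℕ.^ 5) ℕ.* 98) ≡ fromℕ 145 ^ 5 * (fromℕ 29 * (fromℕ 2 + x))
      left = trans (fromℕ-* (145 ℕ.^ 5) 98) (cong₂ _*_ (fromℕ-^ 145 5) (sym 29*[2+x]≡98))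
      right : fromℕ (29 ℕ.* (185 ℕ.^ 5)) ≡ fromℕ 145 ^ 5 * (fromℕ 29 * u ^ 5)
      right = trans (fromℕ-* 29 (185 ℕ.^ 5)) (trans (cong (fromℕ 29 *_) (sym 145⁵*u⁵≡185⁵))
        (solve 3 (λ t D U → t :* (D :* U) := D :* (t :* U)) refl (fromℕ 29) (fromℕ 145 ^ 5) (u ^ 5)))

  -- Otherwise the product of 29 a ≤ 98 and 10000 a⁻¹ ≤ 2959 would give 290000 ≤ 289982.
  2959/10000<root₄⁻¹ : ∀ {a} → Root 4 a → fromℕ 2959 * fromℕ 10000 ⁻¹ < a ⁻¹
  2959/10000<root₄⁻¹ {a} root = ≰⇒> λ a⁻¹≤q →
    <⇒≱ (fromℕ-mono-< (toWitness {a? = 98 ℕ.* 2959 ℕ.<? 29 ℕ.* 10000} tt))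
    (subst₂ _≤_ left right
      (*-mono-≤ (*-nonNeg (0≤fromℕ 29) (proj₁ 0<a))
        (*-nonNeg (0≤fromℕ 10000) (*-nonNeg (0≤fromℕ 2959) (0≤⁻¹ (0<fromℕ 9999))))
        (root₄-≤ root) (*-monoˡ-≤ (0≤fromℕ 10000) a⁻¹≤q)))
    where
    0<a : 0# < a
    0<a = 0<root 4 root
    left : fromℕ 29 * a * (fromℕ 10000 * a ⁻¹) ≡ fromℕ (29 ℕ.* 10000)
    left = trans
      (solve 4 (λ t a m i → t :* a :* (m :* i) := t :* m :* (a :* i)) refl
        (fromℕ 29) a (fromℕ 10000) (a ⁻¹))
      (trans (cong (fromℕ 29 * fromℕ 10000 *_) (inverseʳ 0<a))
      (trans (*-identityʳ _) (sym (fromℕ-* 29 10000))))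
    right : fromℕ 98 * (fromℕ 10000 * (fromℕ 2959 * fromℕ 10000 ⁻¹)) ≡ fromℕ (98 ℕ.* 2959)
    right = trans
      (solve 4 (λ t m n i → t :* (m :* (n :* i)) := t :* n :* (m :* i)) refl
        (fromℕ 98) (fromℕ 10000) (fromℕ 2959) (fromℕ 10000 ⁻¹))
      (trans (cong (fromℕ 98 * fromℕ 2959 *_) (inverseʳ (0<fromℕ 9999)))
      (trans (*-identityʳ _) (sym (fromℕ-* 98 2959))))

  -- The minimum of the ratios over k.

  module _ {α : ℕ → ℝ} (roots : ∀ k → 4 ℕ.≤ k → Root k (α k)) where

    open Max (DecTotalOrder.totalOrder decTotalOrder) using (x≤y⇒x⊔y≈y; x≤y⊔x)

    private
      root₄ : Root 4 (α 4)
      root₄ = roots 4 ℕ.≤-refl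

    α₄⁻¹≤α⁻¹ : ∀ k → 4 ℕ.≤ k → α 4 ⁻¹ ≤ α k ⁻¹
    α₄⁻¹≤α⁻¹ k 4≤k = ⁻¹-anti-≤ (0<root k (roots k 4≤k)) (root-anti-≤ 4≤k root₄ (roots k 4≤k))

    α₄⁻¹≤1/k : ∀ k → suc k ℕ.≤ 3 → α 4 ⁻¹ ≤ fromℕ (suc k) ⁻¹
    α₄⁻¹≤1/k k k≤3 = ⁻¹-anti-≤ (0<fromℕ k) (≤-trans (fromℕ-mono-≤ k≤3) (proj₁ (proj₁ root₄)))

    ratio-isMinimum : IsMinimum⁺ (ratio α) (α 4 ⁻¹)
    -- Attained at k = 4, where α₄ < 4 makes 1 / α₄ the larger entry of the maximum.
    ratio-isMinimum = (4 , _ , x≤y⇒x⊔y≈y (⁻¹-anti-≤ (0<root 4 root₄) (proj₁ (proj₁ (proj₂ root₄))))) , minimal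
      where
      minimal : ∀ k → NonZero k → α 4 ⁻¹ ≤ ratio α k
      minimal 1 _ = α₄⁻¹≤1/k 0 (ℕ.m≤m+n 1 2)
      minimal 2 _ = α₄⁻¹≤1/k 1 (ℕ.m≤m+n 2 1)
      minimal 3 _ = α₄⁻¹≤1/k 2 ℕ.≤-refl
      minimal k@(suc (suc (suc (suc j)))) _ =
        ≤-trans (α₄⁻¹≤α⁻¹ k (ℕ.m≤m+n 4 j)) (x≤y⊔x (fromℕ k ⁻¹) (α k ⁻¹))

-- Finite subsets.

p⊆q⇒p∩q≡p : ∀ {n} {p q : Subset n} → p ⊆ q → p ∩ q ≡ p
p⊆q⇒p∩q≡p {p = p} {q} p⊆q = ⊆-antisym (p∩q⊆p p q) (λ x∈p → x∈p∩q⁺ (x∈p , p⊆q x∈p))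

∣p[x]≔outside∣ : ∀ {n} {p : Subset n} {x} → x ∈ p → suc ∣ p [ x ]≔ outside ∣ ≡ ∣ p ∣
∣p[x]≔outside∣                     here        = refl
∣p[x]≔outside∣ {p = inside ∷ p}  (there x∈p) = cong suc (∣p[x]≔outside∣ x∈p)
∣p[x]≔outside∣ {p = outside ∷ p} (there x∈p) = ∣p[x]≔outside∣ x∈p

p[x]≔outside⊆p : ∀ {n} (p : Subset n) x → p [ x ]≔ outside ⊆ p
p[x]≔outside⊆p (s ∷ p) zero    = out⊆ ⊆-refl
p[x]≔outside⊆p (s ∷ p) (suc x) = s⊆s (p[x]≔outside⊆p p x)

module Algorithms (R : RealNumbers) where

  open RealNumbers R
  open OrderedField R
  open OnlineMaximisation R
  open CommutativeRing commutativeRing using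
    ( ring; *-comm; *-identityʳ; +-comm; +-assoc; +-identityʳ; +-identityˡ
    ; distribˡ; zeroʳ; -‿inverseˡ)
  open RingProperties ring using (+-cancelʳ)

  x-y+y≡x : ∀ x y → (x - y) + y ≡ x
  x-y+y≡x x y = trans (+-assoc x (- y) y) (trans (cong (x +_) (-‿inverseˡ y)) (+-identityʳ x))

  -- Monotone submodular functions of sets of positions.

  record MonotoneSubmodular {n} (v : Subset n → ℝ) : Set where
    field
      mono   : ∀ {S T} → S ⊆ T → v S ≤ v T
      submod : ∀ S T → v (S ∪ T) + v (S ∩ T) ≤ v S + v T

  open MonotoneSubmodular

  old : ∀ {n} → (Subset (suc n) → ℝ) → Subset n → ℝ
  old v T = v (outside ∷ T)

  old-ms : ∀ {n} {v : Subset (suc n) → ℝ} → MonotoneSubmodular v → MonotoneSubmodular (old v)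
  old-ms ms = record
    { mono   = λ S⊆T → mono ms (s⊆s S⊆T)
    ; submod = λ S T → submod ms (outside ∷ S) (outside ∷ T)
    }

  -- Submodularity for `T` and for `S` with the newest element: the union contains `T` with the
  -- newest element, and the intersection contains `S`.
  diminishing : ∀ {n} {v : Subset (suc n) → ℝ} → MonotoneSubmodular v → ∀ {S T} → S ⊆ T →
                v (inside ∷ T) + v (outside ∷ S) ≤ v (outside ∷ T) + v (inside ∷ S)
  diminishing ms {S} {T} S⊆T = ≤-trans
    (+-mono-≤ (mono ms (in⊆in (p⊆p∪q S)))
              (mono ms (s⊆s λ x∈S → x∈p∩q⁺ (S⊆T x∈S , x∈S))))
    (submod ms (outside ∷ T) (inside ∷ S))

  -- By diminishing returns each element of `T` adds at most M - v(∅). The terms are arranged so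
  -- that no subtraction occurs.
  singletons-≤ : ∀ {n} {v : Subset n → ℝ} → MonotoneSubmodular v → ∀ {M} → (∀ x → v ⁅ x ⁆ ≤ M) →
                 ∀ T → v T + fromℕ ∣ T ∣ * v ⊥ ≤ v ⊥ + fromℕ ∣ T ∣ * M
  singletons-≤ {v = v} ms {M} bound [] = ≤-reflexive
    (solve 2 (λ V M → V :+ con 0 :* V := V :+ con 0 :* M) refl (v []) M)
  singletons-≤ ms bound (outside ∷ T) = singletons-≤ (old-ms ms) (bound ∘ suc) T
  singletons-≤ {v = v} ms {M} bound (inside ∷ T) = ≤-by
    (+-mono-≤ (singletons-≤ (old-ms ms) (bound ∘ suc) T)
      (+-mono-≤ (diminishing ms (⊥⊆ {p = T})) (bound zero)))
    (solve 6 (λ X Y B U M N →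
      (X :+ (con 1 :+ N) :* B) :+ ((B :+ N :* M) :+ ((Y :+ U) :+ M))
      := (B :+ (con 1 :+ N) :* M) :+ ((Y :+ N :* B) :+ ((X :+ B) :+ U)))
      refl (v (inside ∷ T)) (v (outside ∷ T)) (v ⊥) (v (inside ∷ ⊥)) M (fromℕ ∣ T ∣))

  -- Keeping the best single element.

  module Single (k : ℕ) .{{_ : NonZero k}} where

    single : ∀ {n} → (Subset (suc n) → ℝ) → Subset n → Subset (suc n)
    single v S with v (outside ∷ S) ≤? v (inside ∷ ⊥)
    ... | yes _ = inside ∷ ⊥
    ... | no _  = outside ∷ S

    single-⊆ : ∀ {n} (v : Subset (suc n) → ℝ) S → single v S ⊆ inside ∷ S
    single-⊆ v S with v (outside ∷ S) ≤? v (inside ∷ ⊥)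
    ... | yes _ = in⊆in ⊥⊆
    ... | no _  = out⊆ ⊆-refl

    single-size : ∀ {n} (v : Subset (suc n) → ℝ) S → ∣ S ∣ ℕ.≤ k → ∣ single v S ∣ ℕ.≤ k
    single-size {n} v S ∣S∣≤k with v (outside ∷ S) ≤? v (inside ∷ ⊥)
    ... | yes _ = subst (λ m → suc m ℕ.≤ k) (sym (∣⊥∣≡0 n)) (ℕ.>-nonZero⁻¹ k)
    ... | no _  = ∣S∣≤k

    single-≥ : ∀ {n} (v : Subset (suc n) → ℝ) S →
               v (outside ∷ S) ≤ v (single v S) × v (inside ∷ ⊥) ≤ v (single v S)
    single-≥ v S with v (outside ∷ S) ≤? v (inside ∷ ⊥)
    ... | yes S≤u = S≤u , ≤-refl
    ... | no  S≰u = ≤-refl , proj₁ (≰⇒> S≰u)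

    singleAlgorithm : OnlineAlgorithm k
    singleAlgorithm = record { update = single ; update-⊆ = single-⊆ ; update-≤ = single-size }

  -- Weights and the lightest kept element.

  weight : ∀ {n} → Subset n → Vec ℝ n → ℝ
  weight []            []       = 0#
  weight (inside ∷ S)  (w ∷ ws) = w + weight S ws
  weight (outside ∷ S) (w ∷ ws) = weight S ws

  weight-remove : ∀ {n} {S : Subset n} ws {x} → x ∈ S →
                  weight (S [ x ]≔ outside) ws + lookup ws x ≡ weight S ws
  weight-remove (w ∷ ws) here = +-comm _ w
  weight-remove {S = inside ∷ S} (w ∷ ws) (there x∈S) =
    trans (+-assoc w _ _) (cong (w +_) (weight-remove ws x∈S))
  weight-remove {S = outside ∷ S} (w ∷ ws) (there x∈S) = weight-remove ws x∈S

  Lightest : ∀ {n} → Subset n → Vec ℝ n → Fin n → Set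
  Lightest S ws x = x ∈ S × (∀ {i} → i ∈ S → lookup ws x ≤ lookup ws i)

  lightest : ∀ {n} (S : Subset n) ws → ∣ S ∣ ≡ 0 ⊎ ∃ (Lightest S ws)
  lightest [] [] = inj₁ refl
  lightest (outside ∷ S) (w ∷ ws) with lightest S ws
  ... | inj₁ ∣S∣≡0           = inj₁ ∣S∣≡0
  ... | inj₂ (x , x∈S , min) = inj₂ (suc x , there x∈S , λ { (there i∈S) → min i∈S })
  lightest (inside ∷ S) (w ∷ ws) with lightest S ws
  ... | inj₁ ∣S∣≡0 = inj₂ (zero , here , λ
    { here → ≤-refl ; (there i∈S) → contradiction (trans (∣p[x]≔outside∣ i∈S) ∣S∣≡0) λ () })
  ... | inj₂ (x , x∈S , min) with lookup ws x ≤? w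
  ...   | yes x≤w = inj₂ (suc x , there x∈S , λ { here → x≤w ; (there i∈S) → min i∈S })
  ...   | no  x≰w = inj₂ (zero , here , λ
    { here → ≤-refl ; (there i∈S) → ≤-trans (proj₁ (≰⇒> x≰w)) (min i∈S) })

  -- `weights` has one entry per arrival, so that it shares its indices with the two subsets.
  record State (n : ℕ) : Set where
    constructor state
    field
      kept accepted : Subset n
      weights       : Vec ℝ n

  open State

  -- The threshold algorithm.

  module Threshold (k : ℕ) .{{_ : NonZero k}} (a : ℝ) where

    private
      K : ℝ
      K = fromℕ k

    slack : ∀ {n} → State n → ℝ
    slack s = a * weight (kept s) (weights s) - weight (accepted s) (weights s)

    trim : ∀ {n} → Subset n → Vec ℝ n → Subset n
    trim S ws with ∣ S ∣ ℕ.<? k | lightest S ws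
    ... | yes _ | _            = S
    -- `S` would be full and empty at once, which a positive `k` excludes; the result is a default
    -- value.
    ... | no _  | inj₁ _       = S
    ... | no _  | inj₂ (x , _) = S [ x ]≔ outside

    step : ∀ {n} → State n → ℝ → State (suc n)
    step s@(state S A ws) y with slack s ≤? K * y
    ... | yes _ = state (inside ∷ trim S ws) (inside ∷ A) (y ∷ ws)
    ... | no _  = state (outside ∷ S) (outside ∷ A) (y ∷ ws)

    -- An online algorithm carries only its set from round to round. The accepted elements and the
    -- weights are therefore recomputed from the current oracle, whose restrictions are the earlier
    -- oracles.
    history : ∀ {n} → (Subset n → ℝ) → State n
    history {zero}  v = state [] [] []
    history {suc n} v = step h (v (inside ∷ accepted h) - v (outside ∷ accepted h))
      where h = history (old v)

    -- Serves to pass from the oracle of one round to the restriction of the next one, which agree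
    -- pointwise.
    history-cong : ∀ {n} {v v′ : Subset n → ℝ} → (∀ T → v T ≡ v′ T) → history v ≡ history v′
    history-cong {zero}  eq = refl
    history-cong {suc n} {v} {v′} eq
      rewrite history-cong {n} {old v} {old v′} (λ T → eq (outside ∷ T)) =
        cong (step h) (cong₂ _-_ (eq (inside ∷ accepted h)) (eq (outside ∷ accepted h)))
      where h = history (old v′)

    trim-⊆ : ∀ {n} (S : Subset n) ws → trim S ws ⊆ S
    trim-⊆ S ws with ∣ S ∣ ℕ.<? k | lightest S ws
    ... | yes _ | _            = ⊆-refl
    ... | no _  | inj₁ _       = ⊆-refl
    ... | no _  | inj₂ (x , _) = p[x]≔outside⊆p S x

    trim-size : ∀ {n} (S : Subset n) ws → ∣ S ∣ ℕ.≤ k → ∣ trim S ws ∣ ℕ.< k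
    trim-size S ws ∣S∣≤k with ∣ S ∣ ℕ.<? k | lightest S ws
    ... | yes ∣S∣<k | _                = ∣S∣<k
    ... | no _      | inj₁ ∣S∣≡0       = subst (ℕ._< k) (sym ∣S∣≡0) (ℕ.>-nonZero⁻¹ k)
    ... | no _      | inj₂ (x , x∈S , _) = subst (ℕ._≤ k) (sym (∣p[x]≔outside∣ x∈S)) ∣S∣≤k

    step-size : ∀ {n} (s : State n) y → ∣ kept s ∣ ℕ.≤ k → ∣ kept (step s y) ∣ ℕ.≤ k
    step-size s y ∣S∣≤k with slack s ≤? K * y
    ... | yes _ = trim-size (kept s) (weights s) ∣S∣≤k
    ... | no _  = ∣S∣≤k

    step-⊆ : ∀ {n} (s : State n) y → kept (step s y) ⊆ inside ∷ kept s
    step-⊆ s y with slack s ≤? K * y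
    ... | yes _ = in⊆in (trim-⊆ (kept s) (weights s))
    ... | no _  = out⊆ ⊆-refl

    history-size : ∀ {n} (v : Subset n → ℝ) → ∣ kept (history v) ∣ ℕ.≤ k
    history-size {zero}  v = ℕ.z≤n
    history-size {suc n} v = step-size (history (old v)) _ (history-size (old v))

    -- The intersection changes nothing in a run of the algorithm; it makes the
    -- update legal for arbitrary S.
    thresholdAlgorithm : OnlineAlgorithm k
    thresholdAlgorithm = record
      { update   = λ v S → kept (history v) ∩ (inside ∷ S)
      ; update-⊆ = λ v S → p∩q⊆q (kept (history v)) (inside ∷ S)
      ; update-≤ = λ v S _ → ℕ.≤-trans (∣p∩q∣≤∣p∣ (kept (history v)) (inside ∷ S)) (history-size v)
      }

    -- The invariant of the threshold algorithm and its preservation.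

    module Analysis (ρ : ℝ) (0≤ρ : 0# ≤ ρ) (a≡ : a ≡ fromℕ 2 + (1# + K) * ρ)
                    (r^≡a : (1# + ρ) ^ suc k ≡ a) where

      private
        r : ℝ
        r = 1# + ρ

        0≤r : 0# ≤ r
        0≤r = 0≤+ 0≤1 0≤ρ

      -- The sum r w₁ + r² w₂ + ... of the invariant in Horner form, the newest element of `S`
      -- coming first.
      discounted : ∀ {n} → Subset n → Vec ℝ n → ℝ
      discounted []            []       = 0#
      discounted (inside ∷ S)  (w ∷ ws) = r * (w + discounted S ws)
      discounted (outside ∷ S) (w ∷ ws) = discounted S ws

      -- The discounted sum is at least m (r + ... + r ^ ∣S∣); multiplication by ρ = r - 1
      -- telescopes this geometric sum.
      discounted-≥ : ∀ {n} (S : Subset n) ws {m} → (∀ {i} → i ∈ S → m ≤ lookup ws i) →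
                     m * r ^ suc ∣ S ∣ ≤ ρ * discounted S ws + m * r
      discounted-≥ [] [] {m} m≤ = ≤-reflexive
        (solve 2 (λ m ρ → m :* ((con 1 :+ ρ) :* con 1) := ρ :* con 0 :+ m :* (con 1 :+ ρ)) refl m ρ)
      discounted-≥ (outside ∷ S) (w ∷ ws) m≤ = discounted-≥ S ws (m≤ ∘ there)
      discounted-≥ (inside ∷ S) (w ∷ ws) {m} m≤ = ≤-by
        (+-mono-≤ (*-monoˡ-≤ 0≤r (discounted-≥ S ws (m≤ ∘ there)))
                  (*-monoˡ-≤ (*-nonNeg 0≤ρ 0≤r) (m≤ here)))
        (solve 5 (λ m ρ w P W → let r = con 1 :+ ρ in
          m :* (r :* W) :+ (r :* (ρ :* P :+ m :* r) :+ ρ :* r :* w)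
          := (ρ :* (r :* (w :+ P)) :+ m :* r) :+ (r :* (m :* W) :+ ρ :* r :* m))
          refl m ρ w (discounted S ws) (r ^ suc ∣ S ∣))

      -- Removal of `x` deletes its term and takes one factor r from each older term. The older
      -- weights are at least that of `x`, so the loss is at least the term that this weight would
      -- have in the oldest position.
      discounted-remove : ∀ {n} (S : Subset n) ws {x} → Lightest S ws x →
                          discounted (S [ x ]≔ outside) ws + r ^ ∣ S ∣ * lookup ws x ≤ discounted S ws
      discounted-remove (inside ∷ S) (w ∷ ws) (here , min) = ≤-by
        (discounted-≥ S ws (min ∘ there))
        (solve 4 (λ ρ w P W → let r = con 1 :+ ρ in
          (P :+ W :* w) :+ (ρ :* P :+ w :* r) := r :* (w :+ P) :+ w :* W)
          refl ρ w (discounted S ws) (r ^ suc ∣ S ∣))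
      discounted-remove (outside ∷ S) (w ∷ ws) (there x∈S , min) = discounted-remove S ws (x∈S , min ∘ there)
      discounted-remove (inside ∷ S) (w ∷ ws) {suc x} (there x∈S , min) = ≤-by
        (*-monoˡ-≤ 0≤r (discounted-remove S ws (x∈S , min ∘ there)))
        (solve 6 (λ r w P Q W m →
          (r :* (w :+ Q) :+ r :* W :* m) :+ r :* P := r :* (w :+ P) :+ r :* (Q :+ W :* m))
          refl r w (discounted S ws) (discounted (S [ x ]≔ outside) ws) (r ^ ∣ S ∣) (lookup ws x))

      -- If nothing has to be removed, take the removed weight m to be zero.
      trim-weight : ∀ {n} (S : Subset n) ws → ∣ S ∣ ℕ.≤ k → ∃ λ m →
                    weight (trim S ws) ws + m ≡ weight S ws ×
                    discounted (trim S ws) ws + r ^ k * m ≤ discounted S ws ×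
                    (∀ {y} → 0# ≤ y → ρ * discounted S ws ≤ ρ * (K * y) → a * m + y ≤ a * y)
      trim-weight S ws ∣S∣≤k with ∣ S ∣ ℕ.<? k | lightest S ws
      ... | yes _     | _ = 0# , +-identityʳ _ ,
        ≤-reflexive (trans (cong (discounted S ws +_) (zeroʳ (r ^ k))) (+-identityʳ _)) ,
        λ {y} 0≤y _ → ≤-by
          (*-monoˡ-≤ (0≤+ 0≤1 (*-nonNeg (0≤+ 0≤1 (0≤fromℕ k)) 0≤ρ)) 0≤y)
          (trans (solve 4 (λ a K ρ y →
              (a :* con 0 :+ y) :+ (con 1 :+ (con 1 :+ K) :* ρ) :* y
              := (con 1 :+ (con 1 :+ con 0) :+ (con 1 :+ K) :* ρ) :* y
                 :+ (con 1 :+ (con 1 :+ K) :* ρ) :* con 0)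
              refl a K ρ y)
            (cong (λ c → c * y + (1# + (1# + K) * ρ) * 0#) (sym a≡)))
      ... | no ∣S∣≮k  | inj₁ ∣S∣≡0 =
        contradiction (subst (ℕ._< k) (sym ∣S∣≡0) (ℕ.>-nonZero⁻¹ k)) ∣S∣≮k
      ... | no ∣S∣≮k  | inj₂ (x , x-min) = m , weight-remove ws (proj₁ x-min) ,
        subst (λ l → discounted (S [ x ]≔ outside) ws + r ^ l * m ≤ discounted S ws) ∣S∣≡k
          (discounted-remove S ws x-min) , a*m+y≤a*y
        where
        m : ℝ
        m = lookup ws x
        ∣S∣≡k : ∣ S ∣ ≡ k
        ∣S∣≡k = ℕ.≤-antisym ∣S∣≤k (ℕ.≮⇒≥ ∣S∣≮k)
        -- The set is full and all its weights are at least `m`, so the exponent in the geometric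
        -- bound is k + 1, and r ^ (k + 1) = a.
        lower : m * (fromℕ 2 + (1# + K) * ρ) ≤ ρ * discounted S ws + m * r
        lower = subst (λ c → m * c ≤ ρ * discounted S ws + m * r)
          (trans (cong (λ l → r ^ suc l) ∣S∣≡k) (trans r^≡a a≡)) (discounted-≥ S ws (proj₂ x-min))
        m≤ : ∀ {y} → 0# ≤ y → ρ * discounted S ws ≤ ρ * (K * y) → m ≤ y
        m≤ {y} 0≤y upper = *-cancelˡ-≤ {1# + K * ρ} (<-≤-trans 0<1 (x≤x+y (*-nonNeg (0≤fromℕ k) 0≤ρ)))
          (≤-by (+-mono-≤ lower (+-mono-≤ upper 0≤y))
            (solve 5 (λ m K ρ y D →
              (con 1 :+ K :* ρ) :* m :+ ((ρ :* D :+ m :* (con 1 :+ ρ)) :+ (ρ :* (K :* y) :+ y))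
              := (con 1 :+ K :* ρ) :* y
                 :+ (m :* (con 1 :+ (con 1 :+ con 0) :+ (con 1 :+ K) :* ρ) :+ (ρ :* D :+ con 0)))
              refl m K ρ y (discounted S ws)))
        -- Here a m ≤ ρ K y + r m ≤ (ρ K + r) y, and ρ K + r = a - 1.
        a*m+y≤a*y : ∀ {y} → 0# ≤ y → ρ * discounted S ws ≤ ρ * (K * y) → a * m + y ≤ a * y
        a*m+y≤a*y {y} 0≤y upper = subst (λ c → c * m + y ≤ c * y) (sym a≡)
          (≤-by (+-mono-≤ lower (+-mono-≤ upper (*-monoˡ-≤ 0≤r (m≤ 0≤y upper))))
            (solve 5 (λ m K ρ y D →
              let r = con 1 :+ ρ
                  a = con 1 :+ (con 1 :+ con 0) :+ (con 1 :+ K) :* ρ in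
              (a :* m :+ y) :+ ((ρ :* D :+ m :* r) :+ (ρ :* (K :* y) :+ r :* y))
              := a :* y :+ (m :* a :+ (ρ :* D :+ r :* m)))
              refl m K ρ y (discounted S ws)))

      -- The weights underestimate the value of each subset of `A`, since every weight was measured
      -- on top of a larger set. Conversely each element of `T` adds at most slack / k to `A`; this
      -- bound is multiplied by `K` to avoid the division. The last field is the invariant.
      record Sound {n} (v : Subset n → ℝ) (s : State n) : Set where
        private
          S = kept s
          A = accepted s
          ws = weights s
        field
          kept⊆accepted  : S ⊆ A
          value-accepted : v A ≡ v ⊥ + weight A ws
          value-≥        : ∀ {T} → T ⊆ A → v ⊥ + weight T ws ≤ v T
          value-≤        : ∀ T → K * v (T ∪ A) ≤ K * v A + fromℕ ∣ T ∣ * slack s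
          slack-≥0       : 0# ≤ slack s
          slack-≥        : discounted S ws ≤ slack s

      open Sound

      slack-eq : ∀ {n} (s : State n) →
                 slack s + weight (accepted s) (weights s) ≡ a * weight (kept s) (weights s)
      slack-eq s = x-y+y≡x _ _

      module _ {n : ℕ} (s : State n) {y : ℝ} (∣S∣≤k : ∣ kept s ∣ ℕ.≤ k)
               (invariant : discounted (kept s) (weights s) ≤ slack s)
               (0≤y : 0# ≤ y) (admit : slack s ≤ K * y) where
        private
          S = kept s
          A = accepted s
          ws = weights s
          S′ = trim S ws
          s′ = state (inside ∷ S′) (inside ∷ A) (y ∷ ws)
          Θ = slack s
          Θ′ = slack s′
          m = proj₁ (trim-weight S ws ∣S∣≤k)

          weight-eq : weight S′ ws + m ≡ weight S ws
          weight-eq = proj₁ (proj₂ (trim-weight S ws ∣S∣≤k))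

          discounted-≤ : discounted S′ ws + r ^ k * m ≤ discounted S ws
          discounted-≤ = proj₁ (proj₂ (proj₂ (trim-weight S ws ∣S∣≤k)))

          a*m+y≤a*y : a * m + y ≤ a * y
          a*m+y≤a*y = proj₂ (proj₂ (proj₂ (trim-weight S ws ∣S∣≤k))) 0≤y
            (*-monoˡ-≤ 0≤ρ (≤-trans invariant admit))

          a*m≡ : a * m ≡ r * r ^ k * m
          a*m≡ = cong (_* m) (sym r^≡a)

          -- Admission raises w(S) by y - m and w(A) by y, hence the slack by a (y - m) - y.
          change : Θ′ + (a * m + y) ≡ Θ + a * y
          change = +-cancelʳ (weight A ws) _ _ (trans
            (solve 5 (λ Θ′ a m y F → (Θ′ :+ (a :* m :+ y)) :+ F := (Θ′ :+ (y :+ F)) :+ a :* m)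
              refl Θ′ a m y (weight A ws))
            (trans (cong (_+ a * m) (slack-eq s′))
            (trans (solve 4 (λ a m y W → a :* (y :+ W) :+ a :* m := a :* (W :+ m) :+ a :* y)
                     refl a m y (weight S′ ws))
            (trans (cong (λ W → a * W + a * y) weight-eq)
            (trans (cong (_+ a * y) (sym (slack-eq s)))
              (solve 3 (λ Θ F z → (Θ :+ F) :+ z := (Θ :+ z) :+ F) refl Θ (weight A ws) (a * y)))))))

          P = discounted S ws
          P′ = discounted S′ ws

        -- Since r · r ^ k = a, the left side is at most r y + r Θ - a m. Here r Θ = Θ + ρ Θ ≤ Θ + ρ
        -- K y, and r + ρ K = a - 1, which gives exactly Θ + (a - 1) y - a m = Θ′.
        admit-slack-≥ : discounted (inside ∷ S′) (y ∷ ws) ≤ Θ′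
        admit-slack-≥ = ≤-by
          (+-mono-≤ (*-monoˡ-≤ 0≤r discounted-≤) (+-mono-≤ (*-monoˡ-≤ 0≤r invariant)
            (+-mono-≤ (*-monoˡ-≤ 0≤ρ admit) (+-mono-≤ (≤-reflexive (sym change)) (≤-reflexive a*m≡)))))
          (trans
            -- The identity holds only with `a` expressed by ρ and `K`; `a≡` is substituted for the
            -- solver and undone afterwards.
            (cong (λ c → r * (y + P′) + (r * P + (r * Θ + (ρ * (K * y) + (Θ′ + (c * m + y) + r * r ^ k * m)))))
              a≡)
          (trans (solve 9 (λ ρ K m y Θ Θ′ P P′ W →
            let r = con 1 :+ ρ
                a = con 1 :+ (con 1 :+ con 0) :+ (con 1 :+ K) :* ρ in
            r :* (y :+ P′) :+ (r :* P :+ (r :* Θ :+ (ρ :* (K :* y) :+ (Θ′ :+ (a :* m :+ y) :+ r :* W :* m))))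
            := Θ′ :+ (r :* (P′ :+ W :* m) :+ (r :* P :+ (ρ :* Θ :+ (Θ :+ a :* y :+ a :* m)))))
            refl ρ K m y Θ Θ′ P P′ (r ^ k))
            (cong (λ c → Θ′ + (r * (P′ + r ^ k * m) + (r * P + (ρ * Θ + (Θ + c * y + c * m))))) (sym a≡))))

        admit-slack-mono : Θ ≤ Θ′
        admit-slack-mono = ≤-by a*m+y≤a*y (sym change)

      step-sound : ∀ {n} {v : Subset (suc n) → ℝ} → MonotoneSubmodular v →
                   ∀ {s} → ∣ kept s ∣ ℕ.≤ k → Sound (old v) s →
                   Sound v (step s (v (inside ∷ accepted s) - v (outside ∷ accepted s)))
      step-sound {v = v} ms {s@(state S A ws)} ∣S∣≤k sound = result
        where
        y : ℝ
        y = v (inside ∷ A) - v (outside ∷ A)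
        y+ : y + v (outside ∷ A) ≡ v (inside ∷ A)
        y+ = x-y+y≡x _ _
        0≤y : 0# ≤ y
        0≤y = ≤-by (mono ms (out⊆ {s = inside} (⊆-refl {x = A})))
          (trans (+-identityˡ _) (sym y+))
        -- The newest element adds to T ∪ A at most what it adds to `A`, so the old bound survives
        -- its insertion on both sides.
        value-∪-≤ : ∀ T → K * v (inside ∷ (T ∪ A)) ≤ K * v (inside ∷ A) + fromℕ ∣ T ∣ * slack s
        value-∪-≤ T = ≤-by
          (+-mono-≤ (value-≤ sound T) (*-monoˡ-≤ (0≤fromℕ k) (diminishing ms (q⊆p∪q T A))))
          (solve 6 (λ K X O I A N →
            K :* X :+ ((K :* A :+ N) :+ K :* (O :+ I)) := (K :* I :+ N) :+ (K :* O :+ K :* (X :+ A)))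
            refl K (v (inside ∷ (T ∪ A))) (v (outside ∷ (T ∪ A))) (v (inside ∷ A)) (v (outside ∷ A))
            (fromℕ ∣ T ∣ * slack s))
        result : Sound v (step s y)
        result with slack s ≤? K * y
        ... | yes admit = record
          { kept⊆accepted = in⊆in (⊆-trans (trim-⊆ S ws) (kept⊆accepted sound))
          ; value-accepted = trans (sym y+) (trans (cong (y +_) (value-accepted sound))
              (solve 3 (λ y V F → y :+ (V :+ F) := V :+ (y :+ F)) refl y (v ⊥) (weight A ws)))
          -- The new weight was measured over `A`, so it is at most the gain over a subset `T` of
          -- `A`.
          ; value-≥ = λ { {inside ∷ T} T⊆A → ≤-by
                            (+-mono-≤ (value-≥ sound (drop-∷-⊆ T⊆A)) (diminishing ms (drop-∷-⊆ T⊆A)))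
                            (trans
                              (solve 6 (λ V y W O B I →
                                (V :+ (y :+ W)) :+ (O :+ (B :+ I)) := I :+ ((V :+ W) :+ ((y :+ B) :+ O)))
                                refl (v ⊥) y (weight T ws) (v (outside ∷ T)) (v (outside ∷ A)) (v (inside ∷ T)))
                                (cong (λ c → v (inside ∷ T) + ((v ⊥ + weight T ws) + (c + v (outside ∷ T)))) y+))
                        ; {outside ∷ T} T⊆A → value-≥ sound (drop-∷-⊆ T⊆A) }
          ; value-≤ = λ { (inside ∷ T) → ≤-trans (value-∪-≤ T) (+-mono-≤ ≤-refl (≤-by
                            (+-mono-≤ (*-monoˡ-≤ (0≤fromℕ ∣ T ∣) slack-mono) (≤-trans (slack-≥0 sound) slack-mono))
                            (solve 3 (λ N Θ Θ′ →
                              N :* Θ :+ (N :* Θ′ :+ Θ′) := (con 1 :+ N) :* Θ′ :+ (N :* Θ :+ con 0))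
                              refl (fromℕ ∣ T ∣) (slack s) _)))
                        ; (outside ∷ T) → ≤-trans (value-∪-≤ T)
                            (+-mono-≤ ≤-refl (*-monoˡ-≤ (0≤fromℕ ∣ T ∣) slack-mono)) }
          ; slack-≥0 = ≤-trans (slack-≥0 sound) slack-mono
          ; slack-≥ = admit-slack-≥ s ∣S∣≤k (slack-≥ sound) 0≤y admit
          }
          where
          slack-mono = admit-slack-mono s ∣S∣≤k (slack-≥ sound) 0≤y admit
        ... | no reject = record
          { kept⊆accepted = s⊆s (kept⊆accepted sound)
          ; value-accepted = value-accepted sound
          ; value-≥ = λ { {inside ∷ T} T⊆A → contradiction (T⊆A here) λ ()
                        ; {outside ∷ T} T⊆A → value-≥ sound (drop-∷-⊆ T⊆A) }
          -- Rejection gives K y ≤ slack. The one additional slack granted to the larger `T`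
          -- therefore pays for dropping the rejected element from the right-hand side.
          ; value-≤ = λ { (inside ∷ T) → ≤-trans (value-∪-≤ T) (≤-by (proj₁ (≰⇒> reject))
                            (trans (solve 4 (λ K I N Θ → (K :* I :+ N :* Θ) :+ Θ := K :* I :+ (con 1 :+ N) :* Θ)
                                refl K (v (inside ∷ A)) (fromℕ ∣ T ∣) (slack s))
                            (trans (cong (λ c → K * c + (1# + fromℕ ∣ T ∣) * slack s) (sym y+))
                              (solve 4 (λ K y O Z → K :* (y :+ O) :+ Z := (K :* O :+ Z) :+ K :* y)
                                refl K y (v (outside ∷ A)) ((1# + fromℕ ∣ T ∣) * slack s)))))
                        ; (outside ∷ T) → value-≤ sound T }
          ; slack-≥0 = slack-≥0 sound
          ; slack-≥ = slack-≥ sound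
          }

      history-sound : ∀ {n} {v : Subset n → ℝ} → MonotoneSubmodular v → Sound v (history v)
      history-sound {zero} {v} ms = record
        { kept⊆accepted = λ ()
        ; value-accepted = sym (+-identityʳ (v []))
        ; value-≥ = λ { {[]} _ → ≤-reflexive (+-identityʳ (v [])) }
        ; value-≤ = λ { [] → ≤-reflexive
            (solve 2 (λ x z → x := x :+ con 0 :* z) refl (K * v []) (slack (state [] [] []))) }
        ; slack-≥0 = ≤-reflexive (sym slack≡0)
        ; slack-≥ = ≤-reflexive (sym slack≡0)
        }
        where
        slack≡0 : slack (state [] [] []) ≡ 0#
        slack≡0 = trans (sym (+-identityʳ _)) (trans (slack-eq (state [] [] [])) (zeroʳ a))
      history-sound {suc n} {v} ms = step-sound ms (history-size (old v)) (history-sound (old-ms ms))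

      kept-competitive : ∀ {n} {v : Subset n → ℝ} → MonotoneSubmodular v → 0# ≤ v ⊥ →
                         ∀ T → ∣ T ∣ ℕ.≤ k → v T ≤ a * v (kept (history v))
      kept-competitive {v = v} ms 0≤v⊥ T ∣T∣≤k = ≤-trans v[T]≤v[A]+Θ (≤-by
        (+-mono-≤ (*-monoˡ-≤ 0≤a (value-≥ sound (kept⊆accepted sound)))
                  -- As a - 1 = 1 + (1 + K) ρ is nonnegative, f(∅) is at most a f(∅).
                  (*-monoˡ-≤ (0≤+ 0≤1 0≤[1+K]ρ) 0≤v⊥))
        (trans (cong (λ c → c + Θ + (a * v S + (1# + (1# + K) * ρ) * v ⊥)) (value-accepted sound))
        (trans (solve 5 (λ V F Θ X c → ((V :+ F) :+ Θ) :+ (X :+ (con 1 :+ c) :* V)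
                                    := (X :+ (con 1 :+ (con 1 :+ con 0) :+ c) :* V) :+ (Θ :+ F))
                 refl (v ⊥) (weight A ws) Θ (a * v S) ((1# + K) * ρ))
        (trans (cong₂ (λ c z → (a * v S + c * v ⊥) + z) (sym a≡) (slack-eq s))
          (solve 5 (λ X a V W c → (X :+ a :* V) :+ a :* W := X :+ (a :* (V :+ W) :+ c :* con 0))
            refl (a * v S) a (v ⊥) (weight S ws) (1# + (1# + K) * ρ))))))
        where
        s = history v
        S = kept s
        A = accepted s
        ws = weights s
        Θ = slack s
        sound : Sound v s
        sound = history-sound ms
        0≤[1+K]ρ : 0# ≤ (1# + K) * ρ
        0≤[1+K]ρ = *-nonNeg (0≤fromℕ (suc k)) 0≤ρ
        0≤a : 0# ≤ a
        0≤a = subst (0# ≤_) (sym a≡) (0≤+ (0≤fromℕ 2) 0≤[1+K]ρ)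
        v[T]≤v[A]+Θ : v T ≤ v A + Θ
        -- At most `k` elements, each adding at most slack / k, add at most the slack.
        v[T]≤v[A]+Θ = *-cancelˡ-≤ 0<K (≤-trans (*-monoˡ-≤ (0≤fromℕ k) (mono ms (p⊆p∪q A)))
          (≤-trans (value-≤ sound T) (subst (K * v A + fromℕ ∣ T ∣ * Θ ≤_) (sym (distribˡ K (v A) Θ))
            (+-mono-≤ ≤-refl (subst₂ _≤_ (*-comm Θ _) (*-comm Θ _)
              (*-monoˡ-≤ (slack-≥0 sound) (fromℕ-mono-≤ ∣T∣≤k)))))))
          where
          0<K : 0# < K
          0<K = subst (λ k → 0# < fromℕ k) (ℕ.suc-pred k) (0<fromℕ (ℕ.pred k))

  -- From set functions on Ω to oracles on positions.

  module _ {Ω : Set} {f : Pred Ω 0ℓ → ℝ} (monotone : Monotone f) (submodular : Submodular f) where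

    ⟦⟧-mono : ∀ {n} (us : Vec Ω n) {S T} → S ⊆ T → ⟦ us ⟧ S Unary.⊆ ⟦ us ⟧ T
    ⟦⟧-mono us S⊆T (i , i∈S , eq) = i , S⊆T i∈S , eq

    value-ms : ∀ {n} (us : Vec Ω n) → MonotoneSubmodular (λ T → f (⟦ us ⟧ T))
    value-ms us = record
      { mono = λ S⊆T → monotone _ _ (⟦⟧-mono us S⊆T)
      ; submod = λ S T → ≤-trans
          (+-mono-≤
            (monotone _ _ λ { (i , i∈S∪T , eq) →
              [ (λ i∈S → inj₁ (i , i∈S , eq)) , (λ i∈T → inj₂ (i , i∈T , eq)) ]′ (x∈p∪q⁻ S T i∈S∪T) })
            (monotone _ _ λ { (i , i∈S∩T , eq) →
              (i , proj₁ (x∈p∩q⁻ S T i∈S∩T) , eq) , (i , proj₂ (x∈p∩q⁻ S T i∈S∩T) , eq) }))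
          (submodular (⟦ us ⟧ S) (⟦ us ⟧ T))
      }

    -- The two predicates have the same elements without being the same predicate; monotonicity in
    -- both directions equates their values.
    old-value : ∀ {n} u (us : Vec Ω n) T → f (⟦ us ⟧ T) ≡ f (⟦ u ∷ us ⟧ (outside ∷ T))
    old-value u us T = ≤-antisym
      (monotone _ _ λ { (i , i∈T , eq) → suc i , there i∈T , eq })
      (monotone _ _ λ { (suc i , there i∈T , eq) → i , i∈T , eq })

    module _ (k : ℕ) .{{_ : NonZero k}} where

      open Single k

      -- The value of the kept set never decreases, and after each arrival it is at least that of
      -- the new singleton.
      singletons-≤-run : ∀ {n} (us : Vec Ω n) x → f (⟦ us ⟧ ⁅ x ⁆) ≤ f (⟦ us ⟧ (run singleAlgorithm f us))
      singletons-≤-run (u ∷ us) zero    = proj₂ (single-≥ (λ T → f (⟦ u ∷ us ⟧ T)) (run singleAlgorithm f us))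
      singletons-≤-run (u ∷ us) (suc x) = ≤-trans
        (subst₂ _≤_ (old-value u us ⁅ x ⁆) (old-value u us _) (singletons-≤-run us x))
        (proj₁ (single-≥ (λ T → f (⟦ u ∷ us ⟧ T)) (run singleAlgorithm f us)))

      -- With t = ∣T∣ and d = k - t, the value of `T` is at most V + t (M - V). This is at most k M
      -- because d V ≤ d M and V ≤ k V.
      single-competitive : NonNegative f → ∀ {n} (us : Vec Ω n) T → ∣ T ∣ ℕ.≤ k →
                           f (⟦ us ⟧ T) ≤ fromℕ k * f (⟦ us ⟧ (run singleAlgorithm f us))
      single-competitive nonNegative us T ∣T∣≤k = subst (λ c → f (⟦ us ⟧ T) ≤ c * M) (sym K≡t+d) (≤-by
        (+-mono-≤ (singletons-≤ (value-ms us) (singletons-≤-run us) T)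
          (+-mono-≤ (*-monoˡ-≤ (0≤fromℕ (k ℕ.∸ ∣ T ∣)) V≤M) (*-mono-≤ 0≤1 0≤V 1≤t+d ≤-refl)))
        (solve 5 (λ X t d V M →
          X :+ ((V :+ t :* M) :+ (d :* M :+ (t :+ d) :* V))
          := (t :+ d) :* M :+ ((X :+ t :* V) :+ (d :* V :+ con 1 :* V)))
          refl (f (⟦ us ⟧ T)) t d V M))
        where
        t d V M : ℝ
        t = fromℕ ∣ T ∣
        d = fromℕ (k ℕ.∸ ∣ T ∣)
        V = f (⟦ us ⟧ ⊥)
        M = f (⟦ us ⟧ (run singleAlgorithm f us))
        V≤M : V ≤ M
        V≤M = monotone _ _ (⟦⟧-mono us ⊥⊆)
        0≤V : 0# ≤ V
        0≤V = nonNegative _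
        K≡t+d : fromℕ k ≡ t + d
        K≡t+d = trans (cong fromℕ (sym (ℕ.m+[n∸m]≡n ∣T∣≤k))) (fromℕ-+ ∣ T ∣ (k ℕ.∸ ∣ T ∣))
        1≤t+d : 1# ≤ t + d
        1≤t+d = subst₂ _≤_ (+-identityʳ 1#) K≡t+d (fromℕ-mono-≤ (ℕ.>-nonZero⁻¹ k))

      module _ (a : ℝ) where

        open Threshold k a

        -- By induction the current set is the kept set of the preceding history, and one step keeps
        -- only its elements and the new one, so the intersection is absorbed.
        run≡kept-history : ∀ {n} (us : Vec Ω n) →
                           run thresholdAlgorithm f us ≡ kept (history (λ T → f (⟦ us ⟧ T)))
        run≡kept-history []       = refl
        run≡kept-history (u ∷ us) = trans
          (cong (λ S → kept (history v) ∩ (inside ∷ S))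
            (trans (run≡kept-history us) (cong kept (history-cong (old-value u us)))))
          (p⊆q⇒p∩q≡p (step-⊆ (history (old v)) _))
          where
          v : Subset _ → ℝ
          v T = f (⟦ u ∷ us ⟧ T)

  -- Competitive ratios.

  module _ {k : ℕ} {a c : ℝ} (0<c : 0# < c) where

    -- Here `a` is the factor reached for the given `k`, and `c` is the common factor α₄ to which it
    -- is weakened.
    competitiveRatio : (A : OnlineAlgorithm k) → a ≤ c →
      (∀ {Ω} (f : Pred Ω 0ℓ → ℝ) → NonNegative f → Monotone f → Submodular f →
        ∀ {n} (us : Vec Ω n) T → ∣ T ∣ ℕ.≤ k → f (⟦ us ⟧ T) ≤ a * f (⟦ us ⟧ (run A f us))) →
      CompetitiveRatioAtLeast A (c ⁻¹)
    competitiveRatio A a≤c bound Ω f nonNegative monotone submodular us _ OPT (∣OPT∣≤k , _) =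
      ⁻¹-*-≤ 0<c (≤-trans (bound f nonNegative monotone submodular us OPT ∣OPT∣≤k)
        (subst₂ _≤_ (*-comm _ a) (*-comm _ c) (*-monoˡ-≤ (nonNegative _) a≤c)))

  open Roots R

  root-competitive : ∀ k .{{_ : NonZero k}} {a} → Root k a → ∀ {Ω} (f : Pred Ω 0ℓ → ℝ) →
                     NonNegative f → Monotone f → Submodular f → ∀ {n} (us : Vec Ω n) T → ∣ T ∣ ℕ.≤ k →
                     f (⟦ us ⟧ T) ≤ a * f (⟦ us ⟧ (run (Threshold.thresholdAlgorithm k a) f us))
  root-competitive k {a} root f nonNegative monotone submodular us T ∣T∣≤k =
    subst (λ S → f (⟦ us ⟧ T) ≤ a * f (⟦ us ⟧ S)) (sym (run≡kept-history monotone submodular k a us))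
      (kept-competitive (value-ms monotone submodular us) (nonNegative _) T ∣T∣≤k)
    where
    -- The increment in the equation of the root, which thus reads (1 + ρ) ^ (k + 1) = a.
    ρ : ℝ
    ρ = (a - fromℕ 2) * fromℕ (suc k) ⁻¹
    a≡ : a ≡ fromℕ 2 + fromℕ (suc k) * ρ
    a≡ = trans (sym (2+[a-2]≡a a)) (cong (fromℕ 2 +_) (sym (trans
      (solve 3 (λ K x i → K :* (x :* i) := x :* (K :* i)) refl
        (fromℕ (suc k)) (a - fromℕ 2) (fromℕ (suc k) ⁻¹))
      (trans (cong ((a - fromℕ 2) *_) (inverseʳ (0<fromℕ k))) (*-identityʳ _)))))
    open Threshold.Analysis k a ρ
      (0≤quotient k (≤-trans 0≤1 (1≤root-2 k root))) a≡ (sym (proj₂ (proj₂ root)))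

  module _ {α : ℕ → ℝ} (roots : ∀ k → 4 ℕ.≤ k → Root k (α k)) where

    private
      root₄ : Root 4 (α 4)
      root₄ = roots 4 ℕ.≤-refl

    algorithm : ∀ k → NonZero k → Σ (OnlineAlgorithm k) λ A → CompetitiveRatioAtLeast A (α 4 ⁻¹)
    algorithm k nz with 4 ℕ.≤? k
    ... | yes 4≤k = thresholdAlgorithm ,
      competitiveRatio (0<root 4 root₄) thresholdAlgorithm (root-anti-≤ 4≤k root₄ (roots k 4≤k))
        (root-competitive k {{nz}} (roots k 4≤k))
      where open Threshold k {{nz}} (α k)
    ... | no 4≰k = singleAlgorithm ,
      competitiveRatio (0<root 4 root₄) singleAlgorithm
        -- The factor of the single-element algorithm is k ≤ 3 < α₄.
        (≤-trans (fromℕ-mono-≤ (ℕ.≤-pred (ℕ.≰⇒> 4≰k))) (proj₁ (proj₁ root₄)))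
        λ f nonNegative monotone submodular us → single-competitive monotone submodular k {{nz}} nonNegative us
      where open Single k {{nz}}

corollary3p1 : (R : RealNumbers) →
  let open RealNumbers R
      open OnlineMaximisation R in
  (α : ℕ → ℝ) → (∀ k → 4 ≤ℕ k → UniqueRoot k (α k)) →
  (∀ k → NonZero k →
    Σ (OnlineAlgorithm k) λ A → CompetitiveRatioAtLeast A (α 4 ⁻¹)) ×
  IsMinimum⁺ (ratio α) (α 4 ⁻¹) ×
  fromℕ 2959 * fromℕ 10000 ⁻¹ < α 4 ⁻¹
corollary3p1 R α unique =
  Algorithms.algorithm R roots , Roots.ratio-isMinimum R roots ,
  Roots.2959/10000<root₄⁻¹ R (roots 4 ℕ.≤-refl)
  where
  roots : ∀ k → 4 ≤ℕ k → OnlineMaximisation.Root R k (α k)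
  roots k 4≤k = proj₁ (unique k 4≤k)
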